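{- Let $k\ge 2$ be a natural number and let $S$ be a $k$-automatic subset of $\mathbb{N}$. Then $S$ forms an asymptotic additive basis for $\mathbb{N}$ if and only if the following conditions both hold: (1) $S$ is not sparse; (2) $\gcd(S)=1$. Moreover, if $S$ is non-sparse and $\gcd(S)=1$, then there exist effectively computable constants $M$ and $N$ such that every natural number greater than or equal to $M$ can be expressed as the sum of at most $N$ elements of $S$.
   Context: $\mathbb{N}=\{0,1,2,\ldots\}$. The canonical base-$k$ expansion of $n\in\mathbb{N}$ is the word over $\{0,1,\ldots,k-1\}$ representing $n$ in base $k$ without leading zeros (the empty word for $n=0$). A set $S\subseteq\mathbb{N}$ is $k$-automatic if the language of canonical base-$k$ expansions of its elements is regular, i.e., accepted by a deterministic finite automaton (DFA); by convention expansions are read by automata starting with the least significant digit. $S$ is an asymptotic additive basis for $\mathbb{N}$ if there exists a constant $j$ such that every sufficiently large natural number can be written as a sum of at most $j$ members of $S$ (repetitions allowed). Let $\pi_S(x)=\#\{n\le x : n\in S\}$. $S$ is sparse if there is an integer $d\ge 0$ with $\pi_S(x)=O((\log x)^d)$; otherwise $S$ is non-sparse. $\gcd(S)$ is the greatest common divisor of all elements of $S$. "Effectively computable" means computable by an algorithm from $k$ and a DFA accepting the base-$k$ expansions of elements of $S$. -}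

module Defs where

open import Data.Digit using (Digit; Expansion; fromDigits; toDigits)
open import Data.Fin.Base using (Fin; zero; suc; toℕ)
open import Data.Fin.Subset using (Subset; _∈_)
open import Data.Fin.Subset.Properties using (_∈?_)
open import Data.List.Base using (List; []; _∷_; [_]; filter; foldl; last; length; sum; upTo)
open import Data.List.Relation.Unary.All using (All)
open import Data.Maybe.Relation.Unary.All as Maybe using (just; nothing)
open import Data.Nat.Base using (ℕ; suc; _+_; _*_; _^_; _≤_; NonZero)
open import Data.Nat.Divisibility using (_∣_)
open import Data.Nat.Logarithm using (⌊log₂_⌋)
open import Data.Product.Base using (Σ; ∃; ∃-syntax; _×_; _,_; proj₂)
open import Function.Bundles using (_⇔_; Equivalence)
open import Level using (0ℓ)
open import Relation.Binary.PropositionalEquality using (_≡_; refl; sym; cong; subst; trans)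
open import Relation.Nullary.Decidable using (map′; fromWitness)
open import Relation.Unary using (Pred; Decidable)

record DFA (A : Set) : Set where
  field
    states : ℕ
    start  : Fin states
    δ      : Fin states → A → Fin states
    final  : Subset states

  Accepts : List A → Set
  Accepts w = foldl δ start w ∈ final

Language : Set → Set₁
Language A = Pred (List A) 0ℓ

Recognises : {A : Set} → DFA A → Language A → Set
Recognises D L = ∀ w → DFA.Accepts D w ⇔ L w

Regular : {A : Set} → Language A → Set
Regular {A} L = Σ (DFA A) λ D → Recognises D L

-- Expansions are least significant digit first, so the leading digit is the
-- last one.  The empty word is canonical and represents 0.
Canonical : ∀ {k} → Expansion k → Set
Canonical w = Maybe.All (λ d → NonZero (toℕ d)) (last w)

expansions : (k : ℕ) → Pred ℕ 0ℓ → Language (Digit k)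
expansions k S w = Canonical w × S (fromDigits w)

Automatic : ℕ → Pred ℕ 0ℓ → Set
Automatic k S = Regular (expansions k S)

strip : ∀ {k} (w : Expansion k) →
        ∃ λ (v : Expansion k) → Canonical v × fromDigits v ≡ fromDigits w
strip []       = [] , nothing , refl
strip {k} (d ∷ w) with strip w
strip {k} (d ∷ w)     | e ∷ v , can , eq = d ∷ e ∷ v , can , cong (λ n → toℕ d + n * k) eq
strip {k} (zero ∷ w)  | []    , _   , eq = [] , nothing , cong (_* k) eq
strip {k} (suc d ∷ w) | []    , _   , eq =
  [ suc d ] , just _ , cong (λ n → toℕ (suc d) + n * k) eq

canonicalExpansion : ∀ {k} → 2 ≤ k → (n : ℕ) →
                     ∃ λ (w : Expansion k) → Canonical w × fromDigits w ≡ n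
canonicalExpansion {k} k≥2 n =
  let w , eq         = toDigits k {fromWitness k≥2} n
      v , can , eq′  = strip w
  in v , can , trans eq′ eq

-- Membership in an automatic set is decided by running the automaton; this is
-- what makes its counting function available constructively.
recognised⇒decidable : ∀ {k} → 2 ≤ k → (S : Pred ℕ 0ℓ) (D : DFA (Digit k)) →
                       Recognises D (expansions k S) → Decidable S
recognised⇒decidable k≥2 S D rec n =
  let w , can , eq = canonicalExpansion k≥2 n
      open Equivalence (rec w)
  in map′ (λ acc → subst S eq (proj₂ (to acc)))
          (λ n∈S → from (can , subst S (sym eq) n∈S))
          (foldl (DFA.δ D) (DFA.start D) w ∈? DFA.final D)

automatic⇒decidable : ∀ {k} → 2 ≤ k → (S : Pred ℕ 0ℓ) → Automatic k S → Decidable S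
automatic⇒decidable k≥2 S (D , rec) = recognised⇒decidable k≥2 S D rec

π : (S : Pred ℕ 0ℓ) → Decidable S → ℕ → ℕ
π S S? x = length (filter S? (upTo (suc x)))

infix 4 _=O_

_=O_ : (ℕ → ℕ) → (ℕ → ℕ) → Set
f =O g = ∃[ C ] ∃[ x₀ ] (∀ x → x₀ ≤ x → f x ≤ C * g x)

-- ⌊log₂ x⌋ and log x agree up to constant factors for x ≥ 2, so this is
-- π_S(x) = O((log x)^d); likewise a natural number C in _=O_ loses nothing.
Sparse : (S : Pred ℕ 0ℓ) → Decidable S → Set
Sparse S S? = ∃[ d ] (π S S? =O λ x → ⌊log₂ x ⌋ ^ d)

-- The greatest element with respect to divisibility, so that the gcd of a
-- subset of {0} is 0.
record IsGCD (S : Pred ℕ 0ℓ) (g : ℕ) : Set where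
  field
    commonDivisor : ∀ {n} → S n → g ∣ n
    greatest      : ∀ {d} → (∀ {n} → S n → d ∣ n) → d ∣ g

SumOfAtMost : ℕ → Pred ℕ 0ℓ → Pred ℕ 0ℓ
SumOfAtMost j S n = ∃ λ (xs : List ℕ) → length xs ≤ j × All S xs × sum xs ≡ n

AsymptoticBasis : Pred ℕ 0ℓ → Set
AsymptoticBasis S = ∃[ j ] ∃[ n₀ ] (∀ n → n₀ ≤ n → SumOfAtMost j S n)

{-# OPTIONS --safe #-}

-- Call a state branching if it is reachable, can reach a final state, and two
-- different letters out of it lead back to it.
--
-- If there is no branching state, each reachable live state has at most one
-- outgoing letter that stays in its strongly connected component, and every
-- other letter strictly decreases the number of reachable states.  Hence the
-- number of accepted words of length at most n is polynomial in n: S is sparse.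
--
-- If q is branching, it carries two loops y, z of equal length ℓ with
-- p = [y] < [z] = p + d.  With K = k ^ ℓ, sums of K − 1 values of words
-- u {y,z}^m w realise every base-K digit in every block, hence a progression
-- A m + E t with 0 ≤ t < K ^ m, where A m = O(K ^ m) and E does not depend on m.
-- Boundedly many copies of these progressions overlap between consecutive
-- levels m.  If gcd S = 1, residues modulo E are supplied by a fixed sum
-- σ ≡ 1 (mod E) of elements of S; pigeonholing words on state, value and place
-- value modulo E shows that words of bounded length already have the same gcd
-- with E as S, so σ can be computed, and so can the bounds.
--
-- Conversely, sums of at most j elements of S number at most (1 + π_S(x))^j up
-- to x, which is polylogarithmic for sparse S.
module Submission where

open import Defs
open import Data.Bool.Properties using (T-≡)
open import Data.Digit using (Digit; Expansion; fromDigits)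
open import Data.Fin.Base using (Fin; zero; suc; toℕ; combine)
open import Data.Fin.Properties
  using (pigeonhole; any?; toℕ-injective; toℕ<n; fromℕ<-injective; fromℕ<-cong;
         combine-injective; injective⇒≤; _≟_)
open import Data.Fin.Subset using (Subset; _∈_; ∣_∣)
open import Data.Fin.Subset.Properties
  using (_∈?_; p⊂q⇒∣p∣<∣q∣; p⊆q⇒∣p∣≤∣q∣; ∣p∣≤n; x∈p⇒∣p-x∣<∣p∣)
open import Data.List.Base
  using (List; []; _∷_; _++_; length; take; drop; foldl; map; filter; lookup; upTo; allFin;
         concatMap; cartesianProductWith)
open import Data.List.Membership.Propositional using () renaming (_∈_ to _∈ˡ_)
open import Data.List.Membership.Propositional.Properties
  using (∈-map⁺; ∈-map⁻; ∈-++⁺ˡ; ∈-++⁺ʳ; ∈-++⁻; ∈-concatMap⁺; ∈-concatMap⁻; ∈-allFin;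
         ∈-upTo⁺; ∈-upTo⁻; ∈-filter⁺; ∈-filter⁻; ∈-cartesianProductWith⁺; ∈-lookup)
open import Data.List.Properties
  using (length-++; length-++-comm; length-take; length-drop; length-map; length-upTo;
         length-tabulate; take++drop≡id; foldl-++)
open import Data.List.Relation.Binary.Subset.Propositional using (_⊆_)
open import Data.List.Relation.Unary.All as All using (All; []; _∷_)
open import Data.List.Relation.Unary.All.Properties using (++⁺)
open import Data.List.Relation.Unary.AllPairs using ([]; _∷_)
open import Data.List.Relation.Unary.Any as Any using (here; there)
open import Data.List.Relation.Unary.Any.Properties using (lookup-index)
open import Data.List.Relation.Unary.Unique.Propositional using (Unique)
open import Data.List.Relation.Unary.Unique.Propositional.Properties
  using (filter⁺; upTo⁺; allFin⁺)
open import Data.Maybe.Relation.Unary.All using (just)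
open import Data.Nat.Base
open import Data.Nat.Divisibility
  using (_∣_; ∣-trans; ∣-refl; ∣n∣m%n⇒∣m; %-presˡ-∣; ∣m+n∣m⇒∣n; ∣m∣n⇒∣m+n; _∣0; ∣1⇒≡1; 1∣_)
open import Data.Nat.DivMod
  using (_mod_; m≡m%n+[m/n]*n; m%n<n; m%n≤n; m<n*o⇒m/o<n; /-monoˡ-≤; m*n/n≡m; [m+kn]%n≡m%n;
         m<n⇒m%n≡m; %-distribˡ-+; %-distribˡ-*)
open import Data.Nat.GCD using (GCD; module Bézout)
open import Data.Nat.Induction using (<-wellFounded)
open import Data.Nat.ListAction using (sum)
open import Data.Nat.ListAction.Properties using (sum-++)
open import Data.Nat.Logarithm using (⌊log₂_⌋; ⌊log₂⌋-mono-≤; ⌊log₂[2^n]⌋≡n)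
open import Data.Nat.Properties as ℕ hiding (_≟_)
open import Data.Nat.Tactic.RingSolver using (solve-∀)
open import Data.Product.Base using (Σ-syntax; ∃; ∃-syntax; ∃₂; _×_; _,_; proj₁; proj₂)
open import Data.Sum.Base using (_⊎_; inj₁; inj₂)
open import Data.Vec.Base using (tabulate)
open import Data.Vec.Properties using (lookup⇒[]=; []=⇒lookup; lookup∘tabulate)
open import Function.Base using (_∘_; case_of_)
open import Function.Bundles using (_⇔_; mk⇔; Equivalence)
open import Induction.WellFounded using (Acc; acc)
open import Level using (0ℓ)
open import Relation.Binary.Definitions using (tri<; tri≈; tri>)
open import Relation.Binary.PropositionalEquality
open import Relation.Nullary.Decidable
  using (Dec; yes; no; map′; _×-dec_; _⊎-dec_; ¬?; isYes; fromWitness; toWitness)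
open import Relation.Nullary.Negation.Core using (¬_; contradiction)
open import Relation.Unary using (Pred; Decidable)

private
  variable
    S T : Pred ℕ 0ℓ
    ℓ ℓ′ m n : ℕ

-- Sums with a prescribed number of summands.

SumOfExactly : ℕ → Pred ℕ 0ℓ → Pred ℕ 0ℓ
SumOfExactly j S n = ∃ λ (xs : List ℕ) → length xs ≡ j × All S xs × sum xs ≡ n

sum-empty : SumOfExactly 0 S 0
sum-empty = [] , refl , [] , refl

sum-+ : SumOfExactly ℓ S m → SumOfExactly ℓ′ S n → SumOfExactly (ℓ + ℓ′) S (m + n)
sum-+ (xs , refl , pxs , refl) (ys , refl , pys , refl) =
  xs ++ ys , length-++ xs , ++⁺ pxs pys , sum-++ xs ys

sum-* : ∀ c → SumOfExactly ℓ S m → SumOfExactly (c * ℓ) S (c * m)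
sum-* zero    _ = sum-empty
sum-* (suc c) p = sum-+ p (sum-* c p)

sum-map : ∀ p q → (∀ {n} → S n → T (p + q * n)) →
          SumOfExactly ℓ S n → SumOfExactly ℓ T (ℓ * p + q * n)
sum-map p q f ([]     , refl , []       , refl) = [] , refl , [] , sym (*-zeroʳ q)
sum-map p q f (x ∷ xs , refl , px ∷ pxs , refl) =
  let ys , len , pys , eq = sum-map p q f (xs , refl , pxs , refl)
  in p + q * x ∷ ys , cong suc len , f px ∷ pys ,
     trans (cong (p + q * x +_) eq) (rearrange p q x (length xs * p) (sum xs))
  where
  rearrange : ∀ p q x l s → p + q * x + (l + q * s) ≡ p + l + q * (x + s)
  rearrange = solve-∀

-- The first `t` summands go through `g` and the others through `f`, so `t` acts as a free digit
-- between 0 and `ℓ` while the number of summands stays fixed.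
sum-choose : ∀ p d q → (∀ {n} → S n → T (p + q * n)) → (∀ {n} → S n → T (p + d + q * n)) →
             ∀ {t} → t ≤ ℓ → SumOfExactly ℓ S n → SumOfExactly ℓ T (ℓ * p + d * t + q * n)
sum-choose {ℓ = ℓ} p d q f g {zero} _ s = subst (SumOfExactly _ _) (eq (ℓ * p) d _) (sum-map p q f s)
  where
  eq : ∀ a d b → a + b ≡ a + d * 0 + b
  eq = solve-∀
sum-choose p d q f g {suc t} (s≤s t≤ℓ) (x ∷ xs , refl , px ∷ pxs , refl) =
  let ys , len , pys , eq = sum-choose p d q f g t≤ℓ (xs , refl , pxs , refl)
  in p + d + q * x ∷ ys , cong suc len , g px ∷ pys ,
     trans (cong (p + d + q * x +_) eq) (rearrange p d q x t (length xs * p) (sum xs))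
  where
  rearrange : ∀ p d q x t l s →
              p + d + q * x + (l + d * t + q * s) ≡ p + l + d * suc t + q * (x + s)
  rearrange = solve-∀

sumOfAtMost : ∀ {j} → ℓ ≤ j → SumOfExactly ℓ S n → SumOfAtMost j S n
sumOfAtMost ℓ≤j (xs , refl , pxs , eq) = xs , ℓ≤j , pxs , eq

-- Progressions inside sums from a self-similar set.

-- With K = 1 + h, the h freely chosen lowest digit blocks p or p + d contribute
-- h p + d t₀ for an arbitrary base-K digit t₀.
module SelfSimilar (T : Pred ℕ 0ℓ) (h p d : ℕ)
  (low  : ∀ {n} → T n → T (p + suc h * n))
  (high : ∀ {n} → T n → T (p + d + suc h * n))
  {w : ℕ} (w∈T : T w) where

  K : ℕ
  K = suc h

  -- This is `h` times the `m`-fold iterate of n ↦ p + K n at `w`.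
  offset : ℕ → ℕ
  offset zero    = h * w
  offset (suc m) = h * p + K * offset m

  -- Since `h * p + p` equals `K * p`, adding `p` turns the affine recursion into multiplication by
  -- `K`.
  offset-closed : ∀ m → offset m + p ≡ (h * w + p) * K ^ m
  offset-closed zero    = sym (*-identityʳ _)
  offset-closed (suc m) = begin
    h * p + K * offset m + p    ≡⟨ step h p (offset m) ⟩
    K * (offset m + p)          ≡⟨ cong (K *_) (offset-closed m) ⟩
    K * ((h * w + p) * K ^ m)   ≡⟨ swap K (h * w + p) (K ^ m) ⟩
    (h * w + p) * K ^ suc m     ∎
    where
    open ≡-Reasoning
    step : ∀ h p o → h * p + suc h * o + p ≡ suc h * (o + p)
    step = solve-∀
    swap : ∀ a b c → a * (b * c) ≡ b * (a * c)
    swap = solve-∀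

  offset-≤ : ∀ m → offset m ≤ (h * w + p) * K ^ m
  offset-≤ m = ≤-trans (m≤m+n _ p) (≤-reflexive (offset-closed m))

  -- Induction along the base-`K` digits of `t`: the lowest digit is at most `h` and counts the
  -- summands that take the larger low block, while the quotient is left to the higher blocks. The
  -- number of summands does not grow with `m`.
  progression : ∀ m {t} → t < K ^ m → SumOfExactly h T (offset m + d * t)
  progression zero {zero} _ =
    subst₂ (λ j → SumOfExactly j T) (*-identityʳ h) (eq (h * w) d)
      (sum-* h (w ∷ [] , refl , w∈T ∷ [] , +-identityʳ w))
    where
    eq : ∀ a d → a ≡ a + d * 0
    eq = solve-∀
  progression zero {suc _} (s≤s ())
  progression (suc m) {t} t<K^m =
    subst (SumOfExactly h T) eq
      (sum-choose p d K low high (≤-pred (m%n<n t K))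
        (progression m (m<n*o⇒m/o<n (<-≤-trans t<K^m (≤-reflexive (*-comm K (K ^ m)))))))
    where
    expand : ∀ hp d K t₀ t₁ o →
             hp + d * t₀ + K * (o + d * t₁) ≡ hp + K * o + d * (t₀ + t₁ * K)
    expand = solve-∀
    eq : h * p + d * (t % K) + K * (offset m + d * (t / K)) ≡ offset (suc m) + d * t
    eq = trans (expand (h * p) d K (t % K) (t / K) (offset m))
               (cong (λ u → offset (suc m) + d * u) (sym (m≡m%n+[m/n]*n t K)))

-- Covering all large numbers by copies of progressions.

-- Greedy distribution: each copy absorbs `W` until the rest of `t` fits into one copy, and the
-- remaining copies take 0. The step stays `E` while the range grows `j`-fold.
sum-copies : ∀ {h} A E W → (∀ {t} → t ≤ W → SumOfExactly h S (A + E * t)) →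
             ∀ j {t} → t ≤ j * W → SumOfExactly (j * h) S (j * A + E * t)
sum-copies A E W f zero    {zero} _ = subst (SumOfExactly 0 _) (sym (*-zeroʳ E)) sum-empty
sum-copies A E W f (suc j) {t} t≤ with ≤-total t W
... | inj₁ t≤W = subst (SumOfExactly _ _) (eq A E (j * A) t)
                   (sum-+ (f t≤W) (sum-copies A E W f j z≤n))
  where
  eq : ∀ A E b t → A + E * t + (b + E * 0) ≡ A + b + E * t
  eq = solve-∀
... | inj₂ W≤t = subst (SumOfExactly _ _) eq
                   (sum-+ (f ≤-refl) (sum-copies A E W f j (m≤n+o⇒m∸n≤o t W t≤)))
  where
  expand : ∀ A E W b t′ → A + E * W + (b + E * t′) ≡ A + b + E * (W + t′)
  expand = solve-∀
  eq : A + E * W + (j * A + E * (t ∸ W)) ≡ suc j * A + E * t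
  eq = trans (expand A E W (j * A) (t ∸ W))
             (cong (λ u → suc j * A + E * u) (m+[n∸m]≡n W≤t))

bracket : ∀ (f : ℕ → ℕ) → f 0 ≤ n → ∀ r → n < f r → ∃[ m ] (f m ≤ n × n < f (suc m))
bracket f f0≤n zero    n<f0 = contradiction f0≤n (<⇒≱ n<f0)
bracket f f0≤n (suc r) n<f with f r ≤? _
... | yes fr≤n = r , fr≤n , n<f
... | no  fr≰n = bracket f f0≤n r (≰⇒> fr≰n)

n<k^n : ∀ {k} → 2 ≤ k → ∀ n → n < k ^ n
n<k^n k≥2 zero    = z<s
n<k^n {k} k≥2 (suc n) = begin-strict
  suc n          ≤⟨ n<k^n k≥2 n ⟩
  k ^ n          <⟨ m<m*n (k ^ n) k {{>-nonZero (≤-trans (s≤s z≤n) (n<k^n k≥2 n))}} k≥2 ⟩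
  k ^ n * k      ≡⟨ *-comm (k ^ n) k ⟩
  k ^ suc n      ∎
  where open ≤-Reasoning

-- The last hypothesis says σ ≡ 1 (mod `E`) without subtraction. Numbers between the thresholds
-- `C * W m` and `C * W (suc m)` are treated with one level of progressions; these thresholds differ
-- by a bounded factor, which keeps the number of copies bounded.
module Covering (S : Pred ℕ 0ℓ) {K : ℕ} (K≥2 : 2 ≤ K) {h E c : ℕ} .{{_ : NonZero E}}
  (A : ℕ → ℕ) (A≤ : ∀ m → A m ≤ c * K ^ m)
  (progression : ∀ m {t} → t < K ^ m → SumOfExactly h S (A m + E * t))
  {r σ u v : ℕ} (unit : SumOfExactly r S σ) (σ≡1 : σ + u * E ≡ 1 + v * E) where

  open ≤-Reasoning

  -- The largest parameter `t` available at level `suc m`. The shift of the exponent keeps it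
  -- positive at `m = 0`.
  W : ℕ → ℕ
  W m = pred (K ^ suc m)

  0<K : 0 < K
  0<K = ≤-trans (s≤s z≤n) K≥2

  suc-W : ∀ m → suc (W m) ≡ K ^ suc m
  suc-W m = suc-pred (K ^ suc m) {{m^n≢0 K (suc m) {{>-nonZero 0<K}}}}

  W≥ : ∀ m → suc m ≤ W m
  W≥ m = ≤-pred (≤-trans (n<k^n K≥2 (suc m)) (≤-reflexive (sym (suc-W m))))

  W>0 : ∀ m → 1 ≤ W m
  W>0 m = ≤-trans (s≤s z≤n) (W≥ m)

  K^≤2W : ∀ m → K ^ suc m ≤ 2 * W m
  K^≤2W m = begin
    K ^ suc m      ≡⟨ suc-W m ⟨
    suc (W m)      ≤⟨ +-monoˡ-≤ (W m) (W>0 m) ⟩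
    W m + W m      ≡⟨ cong (W m +_) (+-identityʳ (W m)) ⟨
    2 * W m        ∎

  W-growth : ∀ m → W (suc m) ≤ K * 2 * W m
  W-growth m = begin
    W (suc m)         ≤⟨ n≤1+n _ ⟩
    suc (W (suc m))   ≡⟨ suc-W (suc m) ⟩
    K * K ^ suc m     ≤⟨ *-monoʳ-≤ K (K^≤2W m) ⟩
    K * (2 * W m)     ≡⟨ *-assoc K 2 (W m) ⟨
    K * 2 * W m       ∎

  top : ℕ → ℕ
  top m = A (suc m) + E * W m

  -- `c′` bounds the ratio of `top m` to `W m`. `slack` leaves room for up to `E` corrections by
  -- `v * E` in `residue`. With at least `j₀` copies the total spread exceeds `top m + slack`. `C`
  -- is large enough to force that many copies, and `maxCopies` is `C` times the growth factor of
  -- `W`.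
  c′ slack j₀ C maxCopies : ℕ
  c′ = c * 2 + E
  slack = E * (E * v)
  j₀ = c′ + slack
  C  = j₀ * c′
  maxCopies  = C * (K * 2)

  top≤ : ∀ m → top m ≤ c′ * W m
  top≤ m = begin
    A (suc m) + E * W m        ≤⟨ +-monoˡ-≤ (E * W m) (≤-trans (A≤ (suc m)) (*-monoʳ-≤ c (K^≤2W m))) ⟩
    c * (2 * W m) + E * W m    ≡⟨ cong (_+ E * W m) (*-assoc c 2 (W m)) ⟨
    c * 2 * W m + E * W m      ≡⟨ *-distribʳ-+ (W m) (c * 2) E ⟨
    c′ * W m                   ∎

  W≤top : ∀ m → W m ≤ top m
  W≤top m = ≤-trans (m≤n*m (W m) E) (m≤n+m (E * W m) (A (suc m)))

  1≤C : 1 ≤ C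
  1≤C = *-mono-≤ {1} {j₀} {1} {c′} (≤-trans 1≤c′ (m≤m+n c′ slack)) 1≤c′
    where
    1≤c′ : 1 ≤ c′
    1≤c′ = ≤-trans (>-nonZero⁻¹ E) (m≤n+m E (c * 2))

  -- ρ copies of σ ≡ 1 (mod E) supply the residue of e modulo E.
  residue : ∀ {e} → slack ≤ e → ∃₂ λ ρ t → ρ ≤ E × e ≡ ρ * σ + E * t
  residue {e} slack≤e = ρ , q′ + ρ * u , m%n≤n e E , eq
    where
    ρ q q′ : ℕ
    ρ  = e % E
    q  = e / E
    q′ = q ∸ ρ * v
    -- Replacing `ρ` by `ρ` copies of `1 + v * E` uses up `ρ * v` multiples of `E`, which are taken
    -- out of the quotient.
    ρv≤q : ρ * v ≤ q
    ρv≤q = begin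
      ρ * v              ≤⟨ *-monoˡ-≤ v (m%n≤n e E) ⟩
      E * v              ≡⟨ m*n/n≡m (E * v) E ⟨
      E * v * E / E      ≤⟨ /-monoˡ-≤ E (≤-trans (≤-reflexive (*-comm (E * v) E)) slack≤e) ⟩
      e / E              ∎
    expand₁ : ∀ ρ q′ E v → ρ + (ρ * v + q′) * E ≡ ρ * (1 + v * E) + E * q′
    expand₁ = solve-∀
    expand₂ : ∀ ρ q′ E u σ → ρ * (σ + u * E) + E * q′ ≡ ρ * σ + E * (q′ + ρ * u)
    expand₂ = solve-∀
    eq : e ≡ ρ * σ + E * (q′ + ρ * u)
    eq = begin-equality
      e                                ≡⟨ m≡m%n+[m/n]*n e E ⟩
      ρ + q * E                        ≡⟨ cong (λ x → ρ + x * E) (m+[n∸m]≡n ρv≤q) ⟨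
      ρ + (ρ * v + q′) * E             ≡⟨ expand₁ ρ q′ E v ⟩
      ρ * (1 + v * E) + E * q′         ≡⟨ cong (λ x → ρ * x + E * q′) σ≡1 ⟨
      ρ * (σ + u * E) + E * q′         ≡⟨ expand₂ ρ q′ E u σ ⟩
      ρ * σ + E * (q′ + ρ * u)         ∎

  -- The maximum of `j` copies overshoots `n` by `deficit`, which their spread can absorb, so
  -- `n = j * A (suc m) + e` with `e` between `slack` and `E * (j * W m)`. Then `residue` splits `e`
  -- into `ρ * σ`, supplied by `unit`, and a multiple of `E`, supplied by the copies.
  level : ∀ m {n} → C * W m ≤ n → n < C * W (suc m) → SumOfAtMost (maxCopies * h + E * r) S n
  level m {n} lower upper =
    let ρ , t , ρ≤E , e≡ = residue slack≤e
        t≤ = *-cancelˡ-≤ {t} {j * W m} E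
               (≤-trans (m≤n+m (E * t) (ρ * σ)) (≤-trans (≤-reflexive (sym e≡)) e≤))
        copies = sum-copies (A (suc m)) E (W m)
                   (λ t≤W → progression (suc m) (≤-trans (s≤s t≤W) (≤-reflexive (suc-W m)))) j t≤
        n≡′ = trans (regroup (j * A (suc m)) E t (ρ * σ))
                (trans (cong (j * A (suc m) +_) (sym e≡)) (sym n≡))
    in subst (SumOfAtMost _ S) n≡′
         (sumOfAtMost (+-mono-≤ (*-monoˡ-≤ h j≤maxCopies) (*-monoˡ-≤ r ρ≤E))
           (sum-+ copies (sum-* ρ unit)))
    where
    instance
      top≢0 : NonZero (top m)
      top≢0 = >-nonZero (≤-trans (W>0 m) (W≤top m))
    -- n = j (A + E W) − deficit, rounding the quotient up, so that n = j A + e.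
    j deficit e : ℕ
    j       = suc (n / top m)
    deficit = top m ∸ n % top m
    e       = j * (E * W m) ∸ deficit

    regroup : ∀ a E t s → a + E * t + s ≡ a + (s + E * t)
    regroup = solve-∀

    j₀≤j : j₀ ≤ j
    j₀≤j = begin
      j₀                          ≡⟨ m*n/n≡m j₀ (top m) ⟨
      j₀ * top m / top m          ≤⟨ /-monoˡ-≤ (top m) j₀top≤n ⟩
      n / top m                   ≤⟨ n≤1+n _ ⟩
      j                           ∎
      where
      j₀top≤n : j₀ * top m ≤ n
      j₀top≤n = begin
        j₀ * top m         ≤⟨ *-monoʳ-≤ j₀ (top≤ m) ⟩
        j₀ * (c′ * W m)    ≡⟨ *-assoc j₀ c′ (W m) ⟨
        C * W m            ≤⟨ lower ⟩
        n                  ∎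

    j≤maxCopies : j ≤ maxCopies
    j≤maxCopies = m<n*o⇒m/o<n (begin-strict
      n                       <⟨ upper ⟩
      C * W (suc m)           ≤⟨ *-monoʳ-≤ C (W-growth m) ⟩
      C * (K * 2 * W m)       ≡⟨ *-assoc C (K * 2) (W m) ⟨
      maxCopies * W m         ≤⟨ *-monoʳ-≤ maxCopies (W≤top m) ⟩
      maxCopies * top m       ∎)

    top+slack≤ : top m + slack ≤ j * (E * W m)
    top+slack≤ = begin
      top m + slack              ≤⟨ +-mono-≤ (top≤ m) (m≤m*n slack (W m) {{>-nonZero (W>0 m)}}) ⟩
      c′ * W m + slack * W m     ≡⟨ *-distribʳ-+ (W m) c′ slack ⟨
      j₀ * W m                   ≤⟨ *-mono-≤ j₀≤j (m≤n*m (W m) E) ⟩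
      j * (E * W m)              ∎

    deficit≤ : deficit ≤ j * (E * W m)
    deficit≤ = ≤-trans (m∸n≤m (top m) (n % top m)) (≤-trans (m≤m+n (top m) slack) top+slack≤)

    slack≤e : slack ≤ e
    slack≤e = m+n≤o⇒n≤o∸m deficit (≤-trans (+-monoˡ-≤ slack (m∸n≤m (top m) (n % top m))) top+slack≤)
      where
      m+n≤o⇒n≤o∸m : ∀ m {n o} → m + n ≤ o → n ≤ o ∸ m
      m+n≤o⇒n≤o∸m m {n} le = m+n≤o⇒m≤o∸n n (≤-trans (≤-reflexive (+-comm n m)) le)

    e≤ : e ≤ E * (j * W m)
    e≤ = ≤-trans (m∸n≤m _ deficit) (≤-reflexive (swap j E (W m)))
      where
      swap : ∀ j E w → j * (E * w) ≡ E * (j * w)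
      swap = solve-∀

    n≡ : n ≡ j * A (suc m) + e
    n≡ = +-cancelʳ-≡ deficit n (j * A (suc m) + e) (begin-equality
      n + deficit                                    ≡⟨ cong (_+ deficit) (m≡m%n+[m/n]*n n (top m)) ⟩
      n % top m + n / top m * top m + deficit        ≡⟨ rotate (n % top m) (n / top m * top m) deficit ⟩
      n % top m + deficit + n / top m * top m 
        ≡⟨ cong (_+ n / top m * top m) (m+[n∸m]≡n (m%n≤n n (top m))) ⟩
      j * top m                                      ≡⟨ *-distribˡ-+ j (A (suc m)) (E * W m) ⟩
      j * A (suc m) + j * (E * W m)                  ≡⟨ cong (j * A (suc m) +_) (m∸n+n≡m deficit≤) ⟨
      j * A (suc m) + (e + deficit)                  ≡⟨ +-assoc (j * A (suc m)) e deficit ⟨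
      j * A (suc m) + e + deficit                    ∎)
      where
      rotate : ∀ a b c → a + b + c ≡ a + c + b
      rotate = solve-∀

  covering : AsymptoticBasis S
  covering = maxCopies * h + E * r , C * W 0 , λ n M≤n →
    -- As `n < W n`, level `n` is a valid start for the downward search.
    let m , lower , upper = bracket (λ m → C * W m) M≤n n
          (≤-trans (W≥ n) (m≤n*m (W n) C {{>-nonZero 1≤C}}))
    in level m lower upper

-- Pigeonholing words, and values of concatenations.

module _ {A : Set} {N : ℕ} (run : List A → Fin N)
  (run-++ : ∀ x y z → run x ≡ run y → run (x ++ z) ≡ run (y ++ z)) where

  -- Pumping down: two of the `N + 1` prefixes of lengths 0 to `N` share a class, and the factor
  -- between them can be cut out. It is stated for an arbitrary right congruence because it serves
  -- both for states alone and for states with residues.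
  shorten : ∀ w → ∃[ v ] (length v < N × run v ≡ run w)
  shorten w = go w (<-wellFounded (length w))
    where
    go : ∀ w → Acc _<_ (length w) → ∃[ v ] (length v < N × run v ≡ run w)
    go w (acc rs) with length w <? N
    ... | yes w<N = w , w<N , refl
    ... | no  w≮N =
      let i , j , i<j , eq = pigeonhole (n<1+n N) (λ i → run (take (toℕ i) w))
          v , v<N , v≡     = go (take (toℕ i) w ++ drop (toℕ j) w) (rs (shorter i<j))
      in v , v<N , (begin
           run v                                      ≡⟨ v≡ ⟩
           run (take (toℕ i) w ++ drop (toℕ j) w)     ≡⟨ run-++ _ _ (drop (toℕ j) w) eq ⟩
           run (take (toℕ j) w ++ drop (toℕ j) w)     ≡⟨ cong run (take++drop≡id (toℕ j) w) ⟩
           run w                                      ∎)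
      where
      open ≡-Reasoning
      shorter : ∀ {i j : Fin (suc N)} → toℕ i < toℕ j →
                length (take (toℕ i) w ++ drop (toℕ j) w) < length w
      shorter {i} {j} i<j = ≤-Reasoning.begin-strict
        length (take (toℕ i) w ++ drop (toℕ j) w)       ≤-Reasoning.≡⟨ length-++ (take (toℕ i) w) ⟩
        length (take (toℕ i) w) + length (drop (toℕ j) w)
          ≤-Reasoning.≡⟨ cong₂ _+_ (length-take (toℕ i) w) (length-drop (toℕ j) w) ⟩
        toℕ i ⊓ length w + (length w ∸ toℕ j)
          ≤-Reasoning.≤⟨ +-monoˡ-≤ _ (m⊓n≤m (toℕ i) (length w)) ⟩
        toℕ i + (length w ∸ toℕ j)                      ≤-Reasoning.<⟨ +-monoˡ-< _ i<j ⟩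
        toℕ j + (length w ∸ toℕ j)
          ≤-Reasoning.≡⟨ m+[n∸m]≡n (≤-trans (≤-pred (toℕ<n j)) (≮⇒≥ w≮N)) ⟩
        length w                                        ≤-Reasoning.∎

fromDigits-++ : ∀ {k} (v w : Expansion k) →
                fromDigits (v ++ w) ≡ fromDigits v + k ^ length v * fromDigits w
fromDigits-++ {k} []      w = sym (+-identityʳ (fromDigits w))
fromDigits-++ {k} (d ∷ v) w = begin
  toℕ d + fromDigits (v ++ w) * k
    ≡⟨ cong (λ x → toℕ d + x * k) (fromDigits-++ v w) ⟩
  toℕ d + (fromDigits v + k ^ length v * fromDigits w) * k
    ≡⟨ rearrange (toℕ d) (fromDigits v) (k ^ length v) (fromDigits w) k ⟩
  toℕ d + fromDigits v * k + k * k ^ length v * fromDigits w ∎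
  where
  open ≡-Reasoning
  rearrange : ∀ d v p w k → d + (v + p * w) * k ≡ d + v * k + k * p * w
  rearrange = solve-∀

-- The lowest digit is the value modulo the base. This separates the values of loops that begin with
-- different letters.
fromDigits-head : ∀ {k} {a b : Digit k} {v w} → fromDigits (a ∷ v) ≡ fromDigits (b ∷ w) → a ≡ b
fromDigits-head {suc k} {a} {b} {v} {w} eq = toℕ-injective (begin
  toℕ a                        ≡⟨ m<n⇒m%n≡m (toℕ<n a) ⟨
  toℕ a % suc k                ≡⟨ [m+kn]%n≡m%n (toℕ a) (fromDigits v) (suc k) ⟨
  fromDigits (a ∷ v) % suc k   ≡⟨ cong (_% suc k) eq ⟩
  fromDigits (b ∷ w) % suc k   ≡⟨ [m+kn]%n≡m%n (toℕ b) (fromDigits w) (suc k) ⟩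
  toℕ b % suc k                ≡⟨ m<n⇒m%n≡m (toℕ<n b) ⟩
  toℕ b                        ∎)
  where open ≡-Reasoning

-- Bézout combinations modulo E.

-- The empty list starts with `E`, congruent to the empty sum. Each further element is merged by
-- Bézout's identity, whose negative coefficient is made nonnegative modulo `E` so that `σ` stays a
-- genuine sum.
bézout : ∀ E .{{_ : NonZero E}} {ss} {S : Pred ℕ 0ℓ} → All S ss →
  ∃[ g ] (g ∣ E × All (g ∣_) ss ×
    ∃₂ λ r σ → ∃₂ λ u v → SumOfExactly r S σ × σ + u * E ≡ g + v * E)
bézout E [] = E , ∣-refl , [] , 0 , 0 , 1 , 0 , sum-empty , refl
bézout (suc E) {s ∷ ss} (s∈S ∷ ss∈S) with bézout (suc E) ss∈S
... | g , g∣E , g∣ss , r , σ , u , v , σ∈ , eq with Bézout.lemma g s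
... | Bézout.result d isGCD identity =
  d , ∣-trans (GCD.gcd∣m isGCD) g∣E , GCD.gcd∣n isGCD ∷ All.map (∣-trans (GCD.gcd∣m isGCD)) g∣ss ,
  combination identity
  where
  open ≡-Reasoning
  s∈ : SumOfExactly 1 _ s
  s∈ = s ∷ [] , refl , s∈S ∷ [] , +-identityʳ s
  regroup : ∀ x σ u e E → x * σ + e + x * u * suc E ≡ x * (σ + u * suc E) + e
  regroup = solve-∀
  combination : Bézout.Identity d g s →
    ∃₂ λ r σ → ∃₂ λ u v → SumOfExactly r _ σ × σ + u * suc E ≡ d + v * suc E
  -- The modulus is `suc E`, so multiplication by `E` acts as negation: `E * y` copies of `s` stand
  -- for -y s here, and `E * x` copies of `σ` for -x σ in the other case.
  combination (Bézout.+- x y d+ys≡xg) =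
    _ , x * σ + E * y * s , x * u , y * s + x * v ,
    sum-+ (sum-* x σ∈) (sum-* (E * y) s∈) , (begin
      x * σ + E * y * s + x * u * suc E      ≡⟨ regroup x σ u (E * y * s) E ⟩
      x * (σ + u * suc E) + E * y * s        ≡⟨ cong (λ z → x * z + E * y * s) eq ⟩
      x * (g + v * suc E) + E * y * s        ≡⟨ distribute x g v E (E * y * s) ⟩
      x * g + x * v * suc E + E * y * s      ≡⟨ cong (λ z → z + x * v * suc E + E * y * s) d+ys≡xg ⟨
      d + y * s + x * v * suc E + E * y * s  ≡⟨ collect d y s (x * v) E ⟩
      d + (y * s + x * v) * suc E            ∎)
    where
    distribute : ∀ x g v E e → x * (g + v * suc E) + e ≡ x * g + x * v * suc E + e
    distribute = solve-∀
    collect : ∀ d y s b E → d + y * s + b * suc E + E * y * s ≡ d + (y * s + b) * suc E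
    collect = solve-∀
  combination (Bézout.-+ x y d+xg≡ys) =
    _ , E * x * σ + y * s , E * x * u , x * g + E * x * v ,
    sum-+ (sum-* (E * x) σ∈) (sum-* y s∈) , (begin
      E * x * σ + y * s + E * x * u * suc E        ≡⟨ regroup (E * x) σ u (y * s) E ⟩
      E * x * (σ + u * suc E) + y * s              ≡⟨ cong₂ (λ z z′ → E * x * z + z′) eq (sym d+xg≡ys) ⟩
      E * x * (g + v * suc E) + (d + x * g)        ≡⟨ collect d x g v E ⟩
      d + (x * g + E * x * v) * suc E              ∎)
    where
    collect : ∀ d x g v E → E * x * (g + v * suc E) + (d + x * g) ≡ d + (x * g + E * x * v) * suc E
    collect = solve-∀

-- Reachability, branching states and accepted words.

module Automaton {k : ℕ} (D : DFA (Digit k)) where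
  open DFA D

  run : Fin states → Expansion k → Fin states
  run = foldl δ

  run-++ : ∀ q v w → run q (v ++ w) ≡ run (run q v) w
  run-++ = foldl-++ δ

  Reach : Fin states → Fin states → Set
  Reach q q′ = ∃[ w ] run q w ≡ q′

  Reach-trans : ∀ {p q r} → Reach p q → Reach q r → Reach p r
  Reach-trans {p} (v , refl) (w , refl) = v ++ w , run-++ p v w

  Reach-step : ∀ q a → Reach q (δ q a)
  Reach-step q a = a ∷ [] , refl

  reachWithin? : ∀ n q q′ → Dec (∃[ w ] (length w ≤ n × run q w ≡ q′))
  reachWithin? zero q q′ =
    map′ (λ q≡q′ → [] , z≤n , q≡q′) (λ where ([] , _ , q≡q′) → q≡q′) (q ≟ q′)
  reachWithin? (suc n) q q′ = map′
    (λ where (inj₁ q≡q′)                  → [] , z≤n , q≡q′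
             (inj₂ (a , w , w≤n , eq))    → a ∷ w , s≤s w≤n , eq)
    (λ where ([] , _ , q≡q′)              → inj₁ q≡q′
             (a ∷ w , s≤s w≤n , eq)       → inj₂ (a , w , w≤n , eq))
    (q ≟ q′ ⊎-dec any? (λ a → reachWithin? n (δ q a) q′))

  -- By `shorten`, words with fewer letters than there are states suffice, so a bounded search
  -- decides.
  reach? : ∀ q q′ → Dec (Reach q q′)
  reach? q q′ = map′
    (λ where (w , _ , eq) → w , eq)
    (λ where (w , eq) → let v , v<N , v≡ = shorten (run q) congruence w
                        in v , <⇒≤ v<N , trans v≡ eq)
    (reachWithin? states q q′)
    where
    congruence : ∀ x y z → run q x ≡ run q y → run q (x ++ z) ≡ run q (y ++ z)
    congruence x y z eq = trans (run-++ q x z) (trans (cong (λ p → run p z) eq) (sym (run-++ q y z)))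

  Live : Fin states → Set
  Live q = ∃[ f ] (f ∈ final × Reach q f)

  live? : Decidable Live
  live? q = any? (λ f → f ∈? final ×-dec reach? q f)

  Branching : Fin states → Set
  Branching q = Reach start q × Live q ×
    ∃₂ λ a b → a ≢ b × Reach (δ q a) q × Reach (δ q b) q

  branching? : Dec (∃ Branching)
  branching? = any? λ q → reach? start q ×-dec live? q ×-dec
    any? λ a → any? λ b → ¬? (a ≟ b) ×-dec reach? (δ q a) q ×-dec reach? (δ q b) q

  -- At the start state of an automaton recognising the expansions of S this is S itself, but it is
  -- defined from the automaton alone, so constants extracted for it depend only on the automaton.
  Value : Fin states → Pred ℕ 0ℓ
  Value q n = ∃[ w ] (run q w ∈ final × fromDigits w ≡ n)

  Value-++ : ∀ q v {n} → Value (run q v) n → Value q (fromDigits v + k ^ length v * n)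
  Value-++ q v (w , w∈ , refl) =
    v ++ w , subst (_∈ final) (sym (run-++ q v w)) w∈ , fromDigits-++ v w

  acceptedHere : Fin states → List (Expansion k)
  acceptedHere q with q ∈? final
  ... | yes _ = [] ∷ []
  ... | no  _ = []

  -- The words of length at most `n` accepted from `q`; the list serves as a search space for `σ`
  -- and as the object to count for sparseness.
  accepted : Fin states → ℕ → List (Expansion k)
  accepted q zero    = acceptedHere q
  accepted q (suc n) =
    acceptedHere q ++ concatMap (λ a → map (a ∷_) (accepted (δ q a) n)) (allFin k)

  acceptedHere-sound : ∀ q {w} → w ∈ˡ acceptedHere q → run q w ∈ final
  acceptedHere-sound q w∈ with q ∈? final
  acceptedHere-sound q (here refl) | yes q∈ = q∈

  acceptedHere-complete : ∀ q → q ∈ final → [] ∈ˡ acceptedHere q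
  acceptedHere-complete q q∈ with q ∈? final
  ... | yes _  = here refl
  ... | no q∉  = contradiction q∈ q∉

  accepted-sound : ∀ q n {w} → w ∈ˡ accepted q n → run q w ∈ final
  accepted-sound q zero    w∈ = acceptedHere-sound q w∈
  accepted-sound q (suc n) w∈ with ∈-++⁻ (acceptedHere q) w∈
  ... | inj₁ w∈′ = acceptedHere-sound q w∈′
  ... | inj₂ w∈′ with Any.satisfied
    (∈-concatMap⁻ (λ a → map (a ∷_) (accepted (δ q a) n)) {xs = allFin k} w∈′)
  ... | a , aw∈ with ∈-map⁻ (a ∷_) aw∈
  ... | w , w∈″ , refl = accepted-sound (δ q a) n w∈″

  accepted-complete : ∀ q n {w} → length w ≤ n → run q w ∈ final → w ∈ˡ accepted q n
  accepted-complete q zero    {[]}    _         q∈ = acceptedHere-complete q q∈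
  accepted-complete q (suc n) {[]}    _         q∈ = ∈-++⁺ˡ (acceptedHere-complete q q∈)
  accepted-complete q (suc n) {a ∷ w} (s≤s w≤n) w∈ =
    ∈-++⁺ʳ (acceptedHere q) (∈-concatMap⁺ (λ a → map (a ∷_) (accepted (δ q a) n))
      (Any.map (λ where refl → ∈-map⁺ (a ∷_) (accepted-complete (δ q a) n w≤n w∈)) (∈-allFin a)))

  -- Residues of values modulo E.

  -- The state together with value and place value modulo E is a finite
  -- right congruence on words, so short accepted words realise every residue.
  residues : ∀ E .{{_ : NonZero E}} {w} → run start w ∈ final →
             ∃[ v ] (v ∈ˡ accepted start (states * (E * E)) × fromDigits v % E ≡ fromDigits w % E)
  residues E {w} w∈ =
    let v , v<N , v≡        = shorten profile congruence w
        run≡ , val≡ , _     = profile-injective v w v≡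
    in v , accepted-complete start (states * (E * E)) (<⇒≤ v<N) (subst (_∈ final) (sym run≡) w∈) , val≡
    where
    open ≡-Reasoning
    -- The place value is recorded because a suffix enters the value multiplied by it.
    profile : Expansion k → Fin (states * (E * E))
    profile w = combine (run start w)
      (combine (fromDigits w mod E) ((k ^ length w) mod E))

    mod⇒% : ∀ a b → a mod E ≡ b mod E → a % E ≡ b % E
    mod⇒% a b = fromℕ<-injective (a % E) (b % E) (m%n<n a E) (m%n<n b E)

    %⇒mod : ∀ a b → a % E ≡ b % E → a mod E ≡ b mod E
    %⇒mod a b eq = fromℕ<-cong (a % E) (b % E) eq (m%n<n a E) (m%n<n b E)

    profile-injective : ∀ v w → profile v ≡ profile w →
      run start v ≡ run start w × fromDigits v % E ≡ fromDigits w % E ×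
      k ^ length v % E ≡ k ^ length w % E
    profile-injective v w eq =
      let v₁ , v₂ = fromDigits v mod E , (k ^ length v) mod E
          w₁ , w₂ = fromDigits w mod E , (k ^ length w) mod E
          run≡ , rest     =
            combine-injective (run start v) (combine v₁ v₂) (run start w) (combine w₁ w₂) eq
          val≡ , place≡   = combine-injective v₁ v₂ w₁ w₂ rest
      in run≡ , mod⇒% (fromDigits v) (fromDigits w) val≡ , mod⇒% (k ^ length v) (k ^ length w) place≡

    +-cong-% : ∀ a b {c d} → a % E ≡ b % E → c % E ≡ d % E → (a + c) % E ≡ (b + d) % E
    +-cong-% a b {c} {d} p q = begin
      (a + c) % E            ≡⟨ %-distribˡ-+ a c E ⟩
      (a % E + c % E) % E    ≡⟨ cong₂ (λ x y → (x + y) % E) p q ⟩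
      (b % E + d % E) % E    ≡⟨ %-distribˡ-+ b d E ⟨
      (b + d) % E            ∎

    *-congˡ-% : ∀ a b c → a % E ≡ b % E → (a * c) % E ≡ (b * c) % E
    *-congˡ-% a b c p = begin
      (a * c) % E                ≡⟨ %-distribˡ-* a c E ⟩
      ((a % E) * (c % E)) % E    ≡⟨ cong (λ x → (x * (c % E)) % E) p ⟩
      ((b % E) * (c % E)) % E    ≡⟨ %-distribˡ-* b c E ⟨
      (b * c) % E                ∎

    congruence : ∀ x y z → profile x ≡ profile y → profile (x ++ z) ≡ profile (y ++ z)
    congruence x y z eq with profile-injective x y eq
    ... | run≡ , val≡ , place≡ = cong₂ combine run-eq
          (cong₂ combine (%⇒mod (fromDigits (x ++ z)) (fromDigits (y ++ z)) val-eq)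
                         (%⇒mod (k ^ length (x ++ z)) (k ^ length (y ++ z)) place-eq))
      where
      run-eq : run start (x ++ z) ≡ run start (y ++ z)
      run-eq = trans (run-++ start x z) (trans (cong (λ q → run q z) run≡) (sym (run-++ start y z)))
      val-eq : fromDigits (x ++ z) % E ≡ fromDigits (y ++ z) % E
      val-eq = begin
        fromDigits (x ++ z) % E                              ≡⟨ cong (_% E) (fromDigits-++ x z) ⟩
        (fromDigits x + k ^ length x * fromDigits z) % E
          ≡⟨ +-cong-% (fromDigits x) (fromDigits y) val≡
               (*-congˡ-% (k ^ length x) (k ^ length y) (fromDigits z) place≡) ⟩
        (fromDigits y + k ^ length y * fromDigits z) % E     ≡⟨ cong (_% E) (fromDigits-++ y z) ⟨
        fromDigits (y ++ z) % E                              ∎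
      place : ∀ x → k ^ length (x ++ z) ≡ k ^ length x * k ^ length z
      place x = trans (cong (k ^_) (length-++ x)) (^-distribˡ-+-* k (length x) (length z))
      place-eq : k ^ length (x ++ z) % E ≡ k ^ length (y ++ z) % E
      place-eq = begin
        k ^ length (x ++ z) % E              ≡⟨ cong (_% E) (place x) ⟩
        (k ^ length x * k ^ length z) % E    ≡⟨ *-congˡ-% (k ^ length x) (k ^ length y) (k ^ length z) place≡ ⟩
        (k ^ length y * k ^ length z) % E    ≡⟨ cong (_% E) (place y) ⟨
        k ^ length (y ++ z) % E              ∎

  Unit : ℕ → Set
  Unit E = ∃₂ λ r σ → ∃₂ λ u v → SumOfExactly r (Value start) σ × σ + u * E ≡ 1 + v * E

  -- `bézout` is run on the finitely many values of short accepted words. If its `g` is not 1, then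
  -- `g` divides `E`, and each value is congruent modulo `E` to a short one by `residues`, so `g`
  -- divides all values.
  unit-or-divisor : ∀ E .{{_ : NonZero E}} →
    Unit E ⊎ ∃[ g ] (g ≢ 1 × (∀ {n} → Value start n → g ∣ n))
  unit-or-divisor E with bézout E {map fromDigits words} {Value start} (All.tabulate value)
    where
    words : List (Expansion k)
    words = accepted start (states * (E * E))
    value : ∀ {n} → n ∈ˡ map fromDigits words → Value start n
    value n∈ = let w , w∈ , eq = ∈-map⁻ fromDigits n∈
               in w , accepted-sound start (states * (E * E)) w∈ , sym eq
  ... | g , g∣E , g∣ss , r , σ , u , v , s , eq with g ℕ.≟ 1
  ... | yes refl = inj₁ (r , σ , u , v , s , eq)
  ... | no  g≢1  = inj₂ (g , g≢1 , λ where
          (w , w∈ , refl) →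
            let v , v∈ , v≡ = residues E {w} w∈
            in ∣n∣m%n⇒∣m g∣E (subst (g ∣_) v≡
                 (%-presˡ-∣ (All.lookup g∣ss (∈-map⁺ fromDigits v∈)) g∣E)))

  -- From a branching state to an asymptotic basis.

  module _ (k≥2 : 2 ≤ k) {q : Fin states} where

    private
      instance
        k≢0 : NonZero k
        k≢0 = >-nonZero (≤-trans (s≤s z≤n) k≥2)

    -- The basis is conditional because `E` must be known before a unit modulo `E` can be sought.
    Modulus : Set
    Modulus = ∃[ E ] (NonZero E × (Unit E → AsymptoticBasis (Value start)))

    -- The loops make `Value q` self-similar with block size `k ^ length y`. Prefixing a path `x`
    -- from the start scales the step `d` by `k ^ length x`, which gives `E`, the same for all
    -- levels.
    loops⇒modulus : ∀ y z → 1 ≤ length y → length y ≡ length z → run q y ≡ q → run q z ≡ q →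
                    fromDigits y < fromDigits z → Reach start q → Live q → Modulus
    loops⇒modulus y z y≥1 y≡z run-y run-z y<z (x , run-x) (f , f∈ , w , run-w) =
      E , E≢0 , λ where
        (r , σ , u , v , s , eq) →
          Covering.covering (Value start) K≥2 {c = c} {{E≢0}} A A≤ progression′ {u = u} {v} s eq
      where
      p d h a E c : ℕ
      p = fromDigits y
      d = fromDigits z ∸ fromDigits y
      h = pred (k ^ length y)
      a = k ^ length x
      E = a * d

      K≡ : suc h ≡ k ^ length y
      K≡ = suc-pred (k ^ length y) {{m^n≢0 k (length y)}}

      low : ∀ {n} → Value q n → Value q (p + suc h * n)
      low {n} n∈ = subst (λ K → Value q (p + K * n)) (sym K≡)
        (Value-++ q y (subst (λ q → Value q n) (sym run-y) n∈))

      high : ∀ {n} → Value q n → Value q (p + d + suc h * n)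
      high {n} n∈ = subst₂ (λ b K → Value q (b + K * n)) (sym (m+[n∸m]≡n (<⇒≤ y<z)))
        (sym (trans K≡ (cong (k ^_) y≡z)))
        (Value-++ q z (subst (λ q → Value q n) (sym run-z) n∈))

      open SelfSimilar (Value q) h p d low high (w , subst (_∈ final) (sym run-w) f∈ , refl)

      K≥2 : 2 ≤ K
      K≥2 = ≤-trans k≥2 (≤-trans (≤-reflexive (sym (*-identityʳ k)))
              (≤-trans (^-monoʳ-≤ k y≥1) (≤-reflexive (sym K≡))))

      E≢0 : NonZero E
      E≢0 = m*n≢0 a d {{m^n≢0 k (length x)}} {{>-nonZero (m<n⇒0<n∸m y<z)}}

      A : ℕ → ℕ
      A m = h * fromDigits x + a * offset m

      c = h * fromDigits x + a * (h * fromDigits w + p)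

      A≤ : ∀ m → A m ≤ c * K ^ m
      A≤ m = begin
        h * fromDigits x + a * offset m
          ≤⟨ +-mono-≤ (m≤m*n (h * fromDigits x) (K ^ m) {{m^n≢0 K m}}) (*-monoʳ-≤ a (offset-≤ m)) ⟩
        h * fromDigits x * K ^ m + a * ((h * fromDigits w + p) * K ^ m)
          ≡⟨ collect (h * fromDigits x) a (h * fromDigits w + p) (K ^ m) ⟩
        c * K ^ m ∎
        where
        open ≤-Reasoning
        collect : ∀ b a e K → b * K + a * (e * K) ≡ (b + a * e) * K
        collect = solve-∀

      progression′ : ∀ m {t} → t < K ^ m → SumOfExactly h (Value start) (A m + E * t)
      progression′ m {t} t<K^m = subst (SumOfExactly h (Value start))
        (expand (h * fromDigits x) a (offset m) d t)
        (sum-map (fromDigits x) a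
          (λ {n} n∈ → Value-++ start x (subst (λ q → Value q n) (sym run-x) n∈))
          (progression m t<K^m))
        where
        expand : ∀ b a o d t → b + a * (o + d * t) ≡ b + a * o + a * d * t
        expand = solve-∀

    -- Traversing the two loops in both orders gives loops of equal length, and their distinct first
    -- letters make the values distinct.
    branching⇒modulus : Branching q → Modulus
    branching⇒modulus (start→q , live , a , b , a≢b , (v , run-v) , (w , run-w)) =
      case <-cmp (fromDigits y) (fromDigits z) of λ where
        (tri< y<z _ _) → loops⇒modulus y z (s≤s z≤n) y~z run-y run-z y<z start→q live
        (tri≈ _ y≡z _) → contradiction (fromDigits-head {v = v ++ b ∷ w} {w ++ a ∷ v} y≡z) a≢b
        (tri> _ _ z<y) → loops⇒modulus z y (s≤s z≤n) (sym y~z) run-z run-y z<y start→q live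
      where
      y z : Expansion k
      y = (a ∷ v) ++ (b ∷ w)
      z = (b ∷ w) ++ (a ∷ v)
      y~z : length y ≡ length z
      y~z = length-++-comm (a ∷ v) (b ∷ w)
      run-y : run q y ≡ q
      run-y = trans (run-++ q (a ∷ v) (b ∷ w)) (trans (cong (λ p → run p (b ∷ w)) run-v) run-w)
      run-z : run q z ≡ q
      run-z = trans (run-++ q (b ∷ w) (a ∷ v)) (trans (cong (λ p → run p (a ∷ v)) run-w) run-v)

-- Counting tools and lengths of canonical expansions.

^-distribʳ-* : ∀ m n o → (m * n) ^ o ≡ m ^ o * n ^ o
^-distribʳ-* m n zero    = refl
^-distribʳ-* m n (suc o) =
  trans (cong (m * n *_) (^-distribʳ-* m n o)) (swap m n (m ^ o) (n ^ o))
  where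
  swap : ∀ a b c d → a * b * (c * d) ≡ a * c * (b * d)
  swap = solve-∀

length-cartesianProductWith : ∀ {A B C : Set} (f : A → B → C) xs ys →
                              length (cartesianProductWith f xs ys) ≡ length xs * length ys
length-cartesianProductWith f []       ys = refl
length-cartesianProductWith f (x ∷ xs) ys =
  trans (length-++ (map (f x) ys))
        (cong₂ _+_ (length-map (f x) ys) (length-cartesianProductWith f xs ys))

module _ {A : Set} where

  lookup-injective : ∀ {xs : List A} → Unique xs → ∀ {i j} →
                           lookup xs i ≡ lookup xs j → i ≡ j
  lookup-injective (x∉ ∷ _)  {zero}  {zero}  _  = refl
  lookup-injective {x ∷ xs} (x∉ ∷ _)  {zero}  {suc j} eq = contradiction eq (All.lookup x∉ (∈-lookup j))
  lookup-injective {x ∷ xs} (x∉ ∷ _)  {suc i} {zero}  eq = contradiction (sym eq) (All.lookup x∉ (∈-lookup i))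
  lookup-injective (_ ∷ uniq) {suc i} {suc j} eq = cong suc (lookup-injective uniq eq)

  unique-⊆⇒length-≤ : ∀ {xs ys : List A} → Unique xs → xs ⊆ ys → length xs ≤ length ys
  unique-⊆⇒length-≤ {xs} {ys} uniq xs⊆ys = injective⇒≤ {f = position} λ {i} {j} eq →
    lookup-injective uniq (begin
      lookup xs i               ≡⟨ lookup-index (xs⊆ys (∈-lookup i)) ⟩
      lookup ys (position i)    ≡⟨ cong (lookup ys) eq ⟩
      lookup ys (position j)    ≡⟨ lookup-index (xs⊆ys (∈-lookup j)) ⟨
      lookup xs j               ∎)
    where
    open ≡-Reasoning
    position : Fin (length xs) → Fin (length ys)
    position i = Any.index (xs⊆ys (∈-lookup i))

  length-concatMap-≤ : ∀ {B : Set} (f : A → List B) {a b} {xs} →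
    All (λ x → length (f x) ≤ b) xs → length (concatMap f xs) ≤ a + length xs * b
  length-concatMap-≤ f {a} {b} [] = z≤n
  length-concatMap-≤ f {a} {b} {x ∷ xs} (px ∷ pxs) = begin
    length (f x ++ concatMap f xs)          ≡⟨ length-++ (f x) ⟩
    length (f x) + length (concatMap f xs)  ≤⟨ +-mono-≤ px (length-concatMap-≤ f pxs) ⟩
    b + (a + length xs * b)                 ≡⟨ swap b a (length xs * b) ⟩
    a + (b + length xs * b)                 ∎
    where
    open ≤-Reasoning
    swap : ∀ b a c → b + (a + c) ≡ a + (b + c)
    swap = solve-∀

  -- This is the shape of the recurrence for accepted words: the one exceptional letter is the one
  -- that can return to the current state.
  length-concatMap-≤-exception : ∀ {B : Set} (f : A → List B) {P : Pred A 0ℓ} (P? : Decidable P) {a b} →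
    (∀ {x y} → P x → P y → x ≡ y) →
    (∀ {x} → P x → length (f x) ≤ a) → (∀ {x} → ¬ P x → length (f x) ≤ b) →
    ∀ {xs} → Unique xs → length (concatMap f xs) ≤ a + length xs * b
  length-concatMap-≤-exception f P? P-unique ≤a ≤b [] = z≤n
  length-concatMap-≤-exception f P? {a} {b} P-unique ≤a ≤b {x ∷ xs} (x∉ ∷ uniq) with P? x
  ... | yes Px = begin
    length (f x ++ concatMap f xs)          ≡⟨ length-++ (f x) ⟩
    length (f x) + length (concatMap f xs)
      ≤⟨ +-mono-≤ (≤a Px) (length-concatMap-≤ f {0} (All.map (λ x≢y → ≤b (x≢y ∘ P-unique Px)) x∉)) ⟩
    a + length xs * b                       ≤⟨ +-monoʳ-≤ a (m≤n+m _ b) ⟩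
    a + (b + length xs * b)                 ∎
    where open ≤-Reasoning
  ... | no ¬Px = begin
    length (f x ++ concatMap f xs)          ≡⟨ length-++ (f x) ⟩
    length (f x) + length (concatMap f xs)
      ≤⟨ +-mono-≤ (≤b ¬Px) (length-concatMap-≤-exception f P? P-unique ≤a ≤b uniq) ⟩
    b + (a + length xs * b)                 ≡⟨ swap b a (length xs * b) ⟩
    a + (b + length xs * b)                 ∎
    where
    open ≤-Reasoning
    swap : ∀ b a c → b + (a + c) ≡ a + (b + c)
    swap = solve-∀

-- The leading digit contributes at least 1, and every digit below it multiplies this by `k`, hence
-- at least doubles it.
canonical-length : ∀ {k} → 2 ≤ k → ∀ d (w : Expansion k) →
                   Canonical (d ∷ w) → 2 ^ length w ≤ fromDigits (d ∷ w)
canonical-length k≥2 d []      (just d≢0) = ≤-trans (>-nonZero⁻¹ (toℕ d) {{d≢0}}) (m≤m+n (toℕ d) 0)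
canonical-length {k} k≥2 d (e ∷ w) can = begin
  2 * 2 ^ length w                     ≤⟨ *-mono-≤ k≥2 (canonical-length k≥2 e w can) ⟩
  k * fromDigits (e ∷ w)               ≡⟨ *-comm k _ ⟩
  fromDigits (e ∷ w) * k               ≤⟨ m≤n+m _ (toℕ d) ⟩
  toℕ d + fromDigits (e ∷ w) * k       ∎
  where open ≤-Reasoning

canonical-length-log : ∀ {k} → 2 ≤ k → (w : Expansion k) → Canonical w → ∀ {x} →
                       fromDigits w ≤ x → length w ≤ suc ⌊log₂ x ⌋
canonical-length-log k≥2 []      can w≤x = z≤n
canonical-length-log k≥2 (d ∷ w) can {x} w≤x = s≤s (begin
  length w                      ≡⟨ ⌊log₂[2^n]⌋≡n (length w) ⟨
  ⌊log₂ 2 ^ length w ⌋          ≤⟨ ⌊log₂⌋-mono-≤ (≤-trans (canonical-length k≥2 d w can) w≤x) ⟩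
  ⌊log₂ x ⌋                     ∎)
  where open ≤-Reasoning

-- Sparseness in the absence of branching states.

module Counting {k : ℕ} (D : DFA (Digit k)) (¬branching : ¬ ∃ (Automaton.Branching D)) where
  open DFA D
  open Automaton D

  reachable : Fin states → Subset states
  reachable q = tabulate (λ q′ → isYes (reach? q q′))

  ∈-reachable⁺ : ∀ {q q′} → Reach q q′ → q′ ∈ reachable q
  ∈-reachable⁺ {q} {q′} r = lookup⇒[]= q′ _
    (trans (lookup∘tabulate _ q′) (Equivalence.to T-≡ (fromWitness {a? = reach? q q′} r)))

  ∈-reachable⁻ : ∀ {q q′} → q′ ∈ reachable q → Reach q q′
  ∈-reachable⁻ {q} {q′} q′∈ = toWitness {a? = reach? q q′}
    (Equivalence.from T-≡ (trans (sym (lookup∘tabulate _ q′)) ([]=⇒lookup q′∈)))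

  rank : Fin states → ℕ
  rank q = ∣ reachable q ∣

  reachable-⊆ : ∀ q a {p} → p ∈ reachable (δ q a) → p ∈ reachable q
  reachable-⊆ q a p∈ = ∈-reachable⁺ (Reach-trans (Reach-step q a) (∈-reachable⁻ p∈))

  rank-≤ : ∀ q a → rank (δ q a) ≤ rank q
  rank-≤ q a = p⊆q⇒∣p∣≤∣q∣ (reachable-⊆ q a)

  -- The state lost is `q` itself.
  rank-< : ∀ q a → ¬ Reach (δ q a) q → rank (δ q a) < rank q
  rank-< q a ¬r = p⊂q⇒∣p∣<∣q∣ (reachable-⊆ q a , q , ∈-reachable⁺ ([] , refl) , ¬r ∘ ∈-reachable⁻)

  stay-unique : ∀ {q} → Reach start q → Live q →
                ∀ {a b} → Reach (δ q a) q → Reach (δ q b) q → a ≡ b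
  stay-unique start→q live {a} {b} ra rb with a ≟ b
  ... | yes a≡b = a≡b
  ... | no  a≢b = contradiction (_ , start→q , live , a , b , a≢b , ra , rb) ¬branching

  acceptedHere-length : ∀ q → length (acceptedHere q) ≤ 1
  acceptedHere-length q with q ∈? final
  ... | yes _ = ≤-refl
  ... | no  _ = z≤n

  dead⇒length≡0 : ∀ {q} n → ¬ Live q → length (accepted q n) ≡ 0
  dead⇒length≡0 {q} n ¬live with accepted q n in eq
  ... | []    = refl
  ... | w ∷ _ = contradiction
    (run q w , accepted-sound q n (subst (w ∈ˡ_) (sym eq) (here refl)) , w , refl) ¬live

  -- Nested induction: the unique letter that can return to `q` lowers only `n`, while each of the
  -- others lowers the rank. A state that is not live contributes nothing.
  accepted-length : ∀ r n {q} → Reach start q → rank q ≤ r →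
                    length (accepted q n) ≤ (suc k * suc n) ^ r
  accepted-length r zero {q} _ _ = ≤-trans (acceptedHere-length q) (m^n>0 (suc k * 1) r)
  -- Every state reaches itself, so the rank is never 0.
  accepted-length zero (suc n) {q} _ rank≤ =
    contradiction (≤-trans (x∈p⇒∣p-x∣<∣p∣ (∈-reachable⁺ {q} ([] , refl))) rank≤) λ ()
  accepted-length (suc r) (suc n) {q} start→q rank≤ with live? q
  ... | no ¬live = ≤-trans (≤-reflexive (dead⇒length≡0 (suc n) ¬live)) z≤n
  ... | yes live = begin
    length (acceptedHere q ++ concatMap extensions (allFin k))
      ≡⟨ length-++ (acceptedHere q) ⟩
    length (acceptedHere q) + length (concatMap extensions (allFin k))
      ≤⟨ +-mono-≤ (acceptedHere-length q)
           (length-concatMap-≤-exception extensions (λ a → reach? (δ q a) q)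
             (stay-unique start→q live) stays leaves (allFin⁺ k)) ⟩
    1 + (suc k * suc n * bound + length (allFin k) * bound)
      ≡⟨ cong (λ l → 1 + (suc k * suc n * bound + l * bound)) (length-tabulate {n = k} (λ x → x)) ⟩
    -- The 1 for the empty word is at most `bound`, and `k + 1` copies of `bound` are exactly the
    -- increment from `suc n` to `suc (suc n)`.
    1 + (suc k * suc n * bound + k * bound)
      ≤⟨ +-monoˡ-≤ _ (m^n>0 (suc k * suc n) r) ⟩
    bound + (suc k * suc n * bound + k * bound)
      ≡⟨ collect k n bound ⟩
    suc k * suc (suc n) * bound
      ≤⟨ *-monoʳ-≤ (suc k * suc (suc n)) (^-monoˡ-≤ r (*-monoʳ-≤ (suc k) (n≤1+n (suc n)))) ⟩
    (suc k * suc (suc n)) ^ suc r ∎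
    where
    open ≤-Reasoning hiding (start)
    bound : ℕ
    bound = (suc k * suc n) ^ r
    extensions : Digit k → List (Expansion k)
    extensions a = map (a ∷_) (accepted (δ q a) n)
    start→δ : ∀ a → Reach start (δ q a)
    start→δ a = Reach-trans start→q (Reach-step q a)
    stays : ∀ {a} → Reach (δ q a) q → length (extensions a) ≤ suc k * suc n * bound
    stays {a} _ = ≤-trans (≤-reflexive (length-map (a ∷_) (accepted (δ q a) n)))
      (accepted-length (suc r) n (start→δ a) (≤-trans (rank-≤ q a) rank≤))
    leaves : ∀ {a} → ¬ Reach (δ q a) q → length (extensions a) ≤ bound
    leaves {a} ¬r = ≤-trans (≤-reflexive (length-map (a ∷_) (accepted (δ q a) n)))
      (accepted-length r n (start→δ a) (≤-pred (≤-trans (rank-< q a ¬r) rank≤)))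
    collect : ∀ k n b → b + (suc k * suc n * b + k * b) ≡ suc k * suc (suc n) * b
    collect = solve-∀

  sparse : 2 ≤ k → (S : Pred ℕ 0ℓ) (S? : Decidable S) →
           (∀ {n} → S n → ∃[ w ] (Canonical w × run start w ∈ final × fromDigits w ≡ n)) →
           Sparse S S?
  -- Starting at 2 ensures `l ≥ 1`, so that `2 + l` is at most `3 * l`; this is the source of the
  -- factor 3.
  sparse k≥2 S S? expand = states , (suc k * 3) ^ states , 2 , λ x x≥2 →
    let l = ⌊log₂ x ⌋ in begin
    π S S? x
      ≤⟨ unique-⊆⇒length-≤ (filter⁺ S? (upTo⁺ (suc x))) (covered x) ⟩
    length (map fromDigits (accepted start (suc l)))
      ≡⟨ length-map fromDigits (accepted start (suc l)) ⟩
    length (accepted start (suc l))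
      ≤⟨ accepted-length states (suc l) ([] , refl) (∣p∣≤n (reachable start)) ⟩
    (suc k * (2 + l)) ^ states
      ≤⟨ ^-monoˡ-≤ states (*-monoʳ-≤ (suc k) (2+l≤3l (⌊log₂⌋-mono-≤ x≥2))) ⟩
    (suc k * (3 * l)) ^ states
      ≡⟨ cong (_^ states) (*-assoc (suc k) 3 l) ⟨
    (suc k * 3 * l) ^ states
      ≡⟨ ^-distribʳ-* (suc k * 3) l states ⟩
    (suc k * 3) ^ states * l ^ states ∎
    where
    open ≤-Reasoning hiding (start)
    2+l≤3l : ∀ {l} → 1 ≤ l → 2 + l ≤ 3 * l
    2+l≤3l {l} 1≤l = ≤-trans (+-monoˡ-≤ l (*-monoʳ-≤ 2 1≤l)) (≤-reflexive (+-comm (2 * l) l))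
    covered : ∀ x → filter S? (upTo (suc x)) ⊆ map fromDigits (accepted start (suc ⌊log₂ x ⌋))
    covered x {n} n∈ =
      let n≤x , n∈S = ∈-filter⁻ S? {v = n} {xs = upTo (suc x)} n∈
          w , can , w∈ , eq = expand n∈S
      in subst (_∈ˡ _) eq (∈-map⁺ fromDigits (accepted-complete start (suc ⌊log₂ x ⌋) {w}
           (canonical-length-log k≥2 w can (≤-trans (≤-reflexive eq) (≤-pred (∈-upTo⁻ n≤x)))) w∈))

-- An asymptotic basis is not sparse.

-- The extra choice 0 pads shorter sums, so `j` independent choices cover every length up to `j`.
sumsOfAtMost : ℕ → List ℕ → List ℕ
sumsOfAtMost zero    xs = 0 ∷ []
sumsOfAtMost (suc j) xs = cartesianProductWith _+_ (0 ∷ xs) (sumsOfAtMost j xs)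

length-sumsOfAtMost : ∀ j xs → length (sumsOfAtMost j xs) ≡ suc (length xs) ^ j
length-sumsOfAtMost zero    xs = refl
length-sumsOfAtMost (suc j) xs =
  trans (length-cartesianProductWith _+_ (0 ∷ xs) (sumsOfAtMost j xs))
        (cong (suc (length xs) *_) (length-sumsOfAtMost j xs))

∈-sumsOfAtMost : ∀ j {xs ys} → length ys ≤ j → All (_∈ˡ xs) ys → sum ys ∈ˡ sumsOfAtMost j xs
∈-sumsOfAtMost zero    z≤n     []         = here refl
∈-sumsOfAtMost (suc j) {xs} z≤n [] =
  ∈-cartesianProductWith⁺ _+_ {xs = 0 ∷ xs} (here refl) (∈-sumsOfAtMost j z≤n [])
∈-sumsOfAtMost (suc j) (s≤s l) (y∈ ∷ ys∈) =
  ∈-cartesianProductWith⁺ _+_ (there y∈) (∈-sumsOfAtMost j l ys∈)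

module _ {S : Pred ℕ 0ℓ} (S? : Decidable S) where

  initial : ℕ → List ℕ
  initial x = filter S? (upTo (suc x))

  summands∈initial : ∀ {x} xs → All S xs → sum xs ≤ x → All (_∈ˡ initial x) xs
  summands∈initial []       []         _  = []
  summands∈initial (y ∷ ys) (py ∷ pys) ≤x =
    ∈-filter⁺ S? (∈-upTo⁺ (s≤s (≤-trans (m≤m+n y (sum ys)) ≤x))) py ∷
    summands∈initial ys pys (≤-trans (m≤n+m (sum ys) y) ≤x)

  -- Each number up to `x` is below `n₀` or is a sum whose summands are themselves at most `x`,
  -- hence one of the listed sums.
  basis-counting : ∀ {j n₀} → (∀ n → n₀ ≤ n → SumOfAtMost j S n) →
                   ∀ x → suc x ≤ n₀ + suc (π S S? x) ^ j
  basis-counting {j} {n₀} basis x = begin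
    suc x                                              ≡⟨ length-upTo (suc x) ⟨
    length (upTo (suc x))                              ≤⟨ unique-⊆⇒length-≤ (upTo⁺ (suc x)) covered ⟩
    length (upTo n₀ ++ sumsOfAtMost j (initial x))     ≡⟨ length-++ (upTo n₀) ⟩
    length (upTo n₀) + length (sumsOfAtMost j (initial x))
      ≡⟨ cong₂ _+_ (length-upTo n₀) (length-sumsOfAtMost j (initial x)) ⟩
    n₀ + suc (π S S? x) ^ j                            ∎
    where
    open ≤-Reasoning
    covered : upTo (suc x) ⊆ upTo n₀ ++ sumsOfAtMost j (initial x)
    covered {n} n∈ with n₀ ≤? n
    ... | no  n₀≰n = ∈-++⁺ˡ (∈-upTo⁺ (≰⇒> n₀≰n))
    ... | yes n₀≤n with basis n n₀≤n
    ... | xs , l , pxs , refl =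
      ∈-++⁺ʳ (upTo n₀) (∈-sumsOfAtMost j l (summands∈initial xs pxs (≤-pred (∈-upTo⁻ n∈))))

n²≤2^n : ∀ n → (4 + n) * (4 + n) ≤ 2 ^ (4 + n)
n²≤2^n zero    = ≤-refl
n²≤2^n (suc n) = begin
  (5 + n) * (5 + n)                                    ≤⟨ m≤m+n _ (n * n + 6 * n + 7) ⟩
  (5 + n) * (5 + n) + (n * n + 6 * n + 7)              ≡⟨ eq n ⟩
  2 * ((4 + n) * (4 + n))                              ≤⟨ *-monoʳ-≤ 2 (n²≤2^n n) ⟩
  2 ^ (5 + n)                                          ∎
  where
  open ≤-Reasoning
  eq : ∀ n → (5 + n) * (5 + n) + (n * n + 6 * n + 7) ≡ 2 * ((4 + n) * (4 + n))
  eq = solve-∀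

-- Witnessed by y = 2 ^ z with z = 4 + c + e, since e z + c < z ^ 2 ≤ 2 ^ z.
polynomial<exponential : ∀ c e N → ∃[ y ] (N ≤ y × 1 ≤ y × c * y ^ e < 2 ^ y)
polynomial<exponential c e N = 2 ^ z , N≤ , m^n>0 2 z , (begin-strict
    c * (2 ^ z) ^ e          ≡⟨ cong (c *_) (^-*-assoc 2 z e) ⟩
    c * 2 ^ (z * e)          <⟨ *-monoˡ-< (2 ^ (z * e)) {{m^n≢0 2 (z * e)}} (n<k^n ≤-refl c) ⟩
    2 ^ c * 2 ^ (z * e)      ≡⟨ ^-distribˡ-+-* 2 c (z * e) ⟨
    2 ^ (c + z * e)          ≤⟨ ^-monoʳ-≤ 2 c+ze≤ ⟩
    2 ^ (2 ^ z)              ∎)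
  where
  open ≤-Reasoning
  z : ℕ
  z = 4 + (c + e + N)
  N≤ : N ≤ 2 ^ z
  N≤ = ≤-trans (m≤n+m N (4 + (c + e))) (<⇒≤ (n<k^n ≤-refl z))
  c+ze≤ : c + z * e ≤ 2 ^ z
  c+ze≤ = begin
    c + z * e        ≤⟨ +-monoˡ-≤ (z * e) (m≤n*m c z) ⟩
    z * c + z * e    ≡⟨ *-distribˡ-+ z c e ⟨
    z * (c + e)      ≤⟨ *-monoʳ-≤ z (≤-trans (m≤m+n (c + e) N) (m≤n+m (c + e + N) 4)) ⟩
    z * z            ≤⟨ n²≤2^n (c + e + N) ⟩
    2 ^ z            ∎

-- At x = 2 ^ y the logarithm is exactly `y`, so sparseness turns the bound of `basis-counting` into
-- a polynomial in `y`, which for suitable large `y` is smaller than 2 ^ y.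
basis⇒¬sparse : ∀ {S : Pred ℕ 0ℓ} (S? : Decidable S) → AsymptoticBasis S → ¬ Sparse S S?
basis⇒¬sparse {S} S? (j , n₀ , basis) (d , C , x₀ , π≤) =
  let y , x₀≤y , 1≤y , poly<exp = polynomial<exponential (n₀ + suc C ^ j) (d * j) x₀
      instance
        y≢0 : NonZero y
        y≢0 = >-nonZero 1≤y
      x₀≤x = ≤-trans x₀≤y (<⇒≤ (n<k^n ≤-refl y))
  in contradiction
    (begin-strict
      2 ^ y                                          <⟨ basis-counting S? basis (2 ^ y) ⟩
      n₀ + suc (π S S? (2 ^ y)) ^ j
        ≤⟨ +-monoʳ-≤ n₀ (^-monoˡ-≤ j (s≤s (π≤ (2 ^ y) x₀≤x))) ⟩
      n₀ + suc (C * ⌊log₂ 2 ^ y ⌋ ^ d) ^ j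
        ≡⟨ cong (λ l → n₀ + suc (C * l ^ d) ^ j) (⌊log₂[2^n]⌋≡n y) ⟩
      n₀ + suc (C * y ^ d) ^ j
        ≤⟨ +-monoʳ-≤ n₀ (^-monoˡ-≤ j (+-monoˡ-≤ (C * y ^ d) (m^n>0 y d))) ⟩
      n₀ + (suc C * y ^ d) ^ j
        ≡⟨ cong (n₀ +_) (^-distribʳ-* (suc C) (y ^ d) j) ⟩
      n₀ + suc C ^ j * (y ^ d) ^ j
        ≡⟨ cong (λ t → n₀ + suc C ^ j * t) (^-*-assoc y d j) ⟩
      n₀ + suc C ^ j * y ^ (d * j)
        ≤⟨ +-monoˡ-≤ _ (m≤m*n n₀ (y ^ (d * j)) {{m^n≢0 y (d * j)}}) ⟩
      n₀ * y ^ (d * j) + suc C ^ j * y ^ (d * j)     ≡⟨ *-distribʳ-+ (y ^ (d * j)) n₀ (suc C ^ j) ⟨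
      (n₀ + suc C ^ j) * y ^ (d * j)                 <⟨ poly<exp ⟩
      2 ^ y                                          ∎)
    (<-irrefl refl)
  where open ≤-Reasoning

-- The gcd of a basis.

∣-sum : ∀ {d} xs → All (d ∣_) xs → d ∣ sum xs
∣-sum []       []         = _ ∣0
∣-sum (x ∷ xs) (px ∷ pxs) = ∣m∣n⇒∣m+n px (∣-sum xs pxs)

-- A common divisor of S divides all large numbers, in particular the consecutive numbers `n₀` and
-- `suc n₀`, and so their difference 1.
basis⇒gcd≡1 : ∀ {S : Pred ℕ 0ℓ} → AsymptoticBasis S → IsGCD S 1
basis⇒gcd≡1 {S} (j , n₀ , basis) = record
  { commonDivisor = λ _ → 1∣ _
  ; greatest      = λ {d} d∣S →
      let divides-large : ∀ n → n₀ ≤ n → d ∣ n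
          divides-large n n₀≤n =
            let xs , _ , pxs , eq = basis n n₀≤n
            in subst (d ∣_) eq (∣-sum xs (All.map d∣S pxs))
      in ∣m+n∣m⇒∣n (subst (d ∣_) (+-comm 1 n₀) (divides-large (suc n₀) (n≤1+n n₀)))
           (divides-large n₀ ≤-refl)
  }

-- Computable bounds and the equivalence.

module _ {k : ℕ} (k≥2 : 2 ≤ k) (D : DFA (Digit k)) where
  open DFA D
  open Automaton D

  Obstructed : Set₁
  Obstructed = ∀ (S : Pred ℕ 0ℓ) (S? : Decidable S) → Recognises D (expansions k S) →
               ¬ Sparse S S? → ¬ IsGCD S 1

  -- The case is decided from the automaton before any S is given. Without a branching state every
  -- recognised S is sparse; with a divisor `g ≢ 1` of all values its gcd is not 1.
  basis-or-obstructed : AsymptoticBasis (Value start) ⊎ Obstructed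
  basis-or-obstructed with branching?
  ... | no ¬branching = inj₂ λ S S? rec ¬sparse _ → ¬sparse
    (Counting.sparse D ¬branching k≥2 S S? λ {n} n∈S →
      let w , can , eq = canonicalExpansion k≥2 n
      in w , can , Equivalence.from (rec w) (can , subst S (sym eq) n∈S) , eq)
  ... | yes (q , branching) with branching⇒modulus k≥2 branching
  ... | E , E≢0 , basis with unit-or-divisor E {{E≢0}}
  ... | inj₁ unit = inj₁ (basis unit)
  ... | inj₂ (g , g≢1 , g∣S) = inj₂ λ S S? rec _ gcd≡1 →
    g≢1 (∣1⇒≡1 (IsGCD.greatest gcd≡1 λ {n} n∈S →
      let w , can , eq = canonicalExpansion k≥2 n
      in g∣S (w , Equivalence.from (rec w) (can , subst S (sym eq) n∈S) , eq)))

-- A closed function of `k` and the automaton, with no proof about S as input: this renders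
-- effective computability.
bounds : ∀ k → DFA (Digit k) → ℕ × ℕ
bounds k D with 2 ≤? k
... | no _ = 0 , 0
... | yes k≥2 with basis-or-obstructed k≥2 D
...   | inj₁ (N , M , _) = M , N
-- A default value: no set recognised by such an automaton satisfies both hypotheses.
...   | inj₂ _           = 0 , 0

-- The hypotheses refute the obstructed case, so the bounds come from a basis for `Value start`, and
-- accepted words have their values in S.
bounds-correct : ∀ k → 2 ≤ k → (S : Pred ℕ 0ℓ) (D : DFA (Digit k)) → Recognises D (expansions k S) →
                 (S? : Decidable S) → ¬ Sparse S S? → IsGCD S 1 →
                 ∀ n → proj₁ (bounds k D) ≤ n → SumOfAtMost (proj₂ (bounds k D)) S n
bounds-correct k k≥2 S D rec S? ¬sparse gcd≡1 n M≤n with 2 ≤? k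
... | no k≱2 = contradiction k≥2 k≱2
... | yes k≥2′ with basis-or-obstructed k≥2′ D
...   | inj₂ obstructed = contradiction gcd≡1 (obstructed S S? rec ¬sparse)
...   | inj₁ (N , M , basis) =
  let xs , l , pxs , eq = basis n M≤n
  in xs , l , All.map (λ (w , w∈ , eq) → subst S eq (proj₂ (Equivalence.to (rec w) w∈))) pxs , eq

theorem1p1 : (∀ (k : ℕ) (k≥2 : 2 ≤ k) (S : Pred ℕ 0ℓ) (aut : Automatic k S) →
    AsymptoticBasis S ⇔ (¬ Sparse S (automatic⇒decidable k≥2 S aut) × IsGCD S 1))
    ×
    (Σ[ M ∈ ((k : ℕ) → DFA (Digit k) → ℕ) ]
    Σ[ N ∈ ((k : ℕ) → DFA (Digit k) → ℕ) ]
    (∀ (k : ℕ) (k≥2 : 2 ≤ k) (S : Pred ℕ 0ℓ)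
    (D : DFA (Digit k)) (rec : Recognises D (expansions k S)) →
    ¬ Sparse S (recognised⇒decidable k≥2 S D rec) → IsGCD S 1 →
    ∀ n → M k D ≤ n → SumOfAtMost (N k D) S n))
theorem1p1 =
  (λ k k≥2 S aut@(D , rec) → mk⇔
    (λ basis → basis⇒¬sparse (automatic⇒decidable k≥2 S aut) basis , basis⇒gcd≡1 basis)
    -- The converse direction is the effective statement: the computed bounds witness the basis.
    (λ (¬sparse , gcd≡1) → proj₂ (bounds k D) , proj₁ (bounds k D) ,
      bounds-correct k k≥2 S D rec (recognised⇒decidable k≥2 S D rec) ¬sparse gcd≡1)) ,
  (λ k D → proj₁ (bounds k D)) , (λ k D → proj₂ (bounds k D)) ,
  λ k k≥2 S D rec → bounds-correct k k≥2 S D rec (recognised⇒decidable k≥2 S D rec)
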